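{- Let $m\geq 1$. The number of descending plane partitions of dimension $m$ is $$\det\left(\binom{i+j-1}{j-1}+\delta_{i,j}-\delta_{i+1,j}\right)_{1\leq i,j\leq m-1}.$$
   Context: A descending plane partition is a (possibly empty) array $\pi=(a_{i,j})$ of positive integers with rows $i=1,\dots,k$, where row $i$ is nonempty and consists of the entries $a_{i,i},a_{i,i+1},\dots,a_{i,\mu_i}$ (so $\mu_i\geq i$ and row $i$ has length $\mu_i-i+1$), such that: (1) rows are weakly decreasing: $a_{i,j}\geq a_{i,j+1}$ for $1\leq i\leq k$ and $i\leq j<\mu_i$; (2) columns are strictly decreasing: $a_{i,j}>a_{i+1,j}$ for $1\leq i\leq k-1$ and $i<j\leq\mu_{i+1}$; (3) $a_{i,i}>\mu_i-i+1$ for $1\leq i\leq k$, i.e. the first part of each row is greater than the length of that row; (4) $a_{i,i}\leq\mu_{i-1}-(i-1)+1$ for $2\leq i\leq k$, i.e. the first part of each row is at most the length of the preceding row. (These conditions imply $\mu_1\geq\mu_2\geq\cdots\geq\mu_k\geq k$.) The empty array is a descending plane partition. The parts of $\pi$ are the numbers, with repetitions, appearing in the array. $\pi$ has dimension $m$ if no part is greater than $m$ (so the count includes the empty array). Here $\delta_{x,y}$ is the Kronecker delta, and the determinant of the empty ($0\times 0$) matrix is $1$. -}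

module Defs where

open import Algebra.Properties.Semiring.Sum using (sum)
open import Data.Bool.Base using (if_then_else_)
open import Data.Fin.Base using (Fin; zero; suc; toℕ; punchIn)
open import Data.Integer.Base as ℤ using (ℤ; +_; 0ℤ; 1ℤ; -1ℤ)
import Data.Integer.Properties as ℤ
open import Data.List.Base using (List)
import Data.List.Base as List
open import Data.List.Membership.Propositional using (_∈_)
open import Data.List.NonEmpty.Base using (List⁺; toList; head; tail; length)
open import Data.List.Relation.Binary.Prefix.Heterogeneous using (Prefix)
open import Data.List.Relation.Unary.All using (All)
open import Data.List.Relation.Unary.Linked using (Linked)
open import Data.List.Relation.Unary.Unique.Propositional using (Unique)
open import Data.Nat.Base using (ℕ; zero; suc; _+_; _∸_; _≤_; _<_; _≥_)
open import Data.Nat.Combinatorics using (_C_)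
open import Data.Nat.Properties using (_≟_)
open import Data.Product.Base using (∃-syntax; _×_)
open import Function.Bundles using (_⇔_)
open import Relation.Binary.PropositionalEquality.Core using (_≡_)
open import Relation.Nullary.Decidable.Core using (does)

-- A shifted array (a_{i,j}) given by its rows: the i-th row, counted from 1,
-- lists a_{i,i}, a_{i,i+1}, …, a_{i,μᵢ}, so its length is μᵢ - i + 1.
ShiftedArray : Set
ShiftedArray = List (List⁺ ℕ)

record IsDescendingPlanePartition (π : ShiftedArray) : Set where
  field
    positive       : All (λ r → All (0 <_) (toList r)) π
    rows-weak      : All (λ r → Linked _≥_ (toList r)) π
    -- Row i+1 starts one column to the right of row i, so below row r the row s
    -- lies under tail r: each entry of s is less than the entry above it.  That
    -- these entries above exist (μᵢ₊₁ ≤ μᵢ) already follows from the last two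
    -- conditions.
    columns-strict : Linked (λ r s → Prefix _<_ (toList s) (tail r)) π
    length<first   : All (λ r → length r < head r) π
    first≤previous : Linked (λ r s → head s ≤ length r) π

HasDimension : ℕ → ShiftedArray → Set
HasDimension m π = All (λ r → All (_≤ m) (toList r)) π

-- Exactly n elements satisfy P: a duplicate-free list of length n enumerates them.
HasCardinality : {A : Set} → (A → Set) → ℕ → Set
HasCardinality {A} P n =
  ∃[ xs ] (Unique xs × ((x : A) → x ∈ xs ⇔ P x) × List.length xs ≡ n)

SquareMatrix : ℕ → Set
SquareMatrix n = Fin n → Fin n → ℤ

minor : ∀ {n} → SquareMatrix (suc n) → Fin (suc n) → SquareMatrix n
minor A j i k = A (suc i) (punchIn j k)

-- Laplace expansion along the first row.
det : ∀ {n} → SquareMatrix n → ℤ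
det {zero}  A = 1ℤ
det {suc n} A = sum ℤ.+-*-semiring
  (λ j → -1ℤ ℤ.^ toℕ j ℤ.* A zero j ℤ.* det (minor A j))

δ : ℕ → ℕ → ℤ
δ x y = if does (x ≟ y) then 1ℤ else 0ℤ

-- The (i, j) entry for indices i, j counted from 1.
entry : ℕ → ℕ → ℤ
entry i j = + ((i + j ∸ 1) C (j ∸ 1)) ℤ.+ δ i j ℤ.- δ (i + 1) j

dppMatrix : ∀ n → SquareMatrix n
dppMatrix n i j = entry (suc (toℕ i)) (suc (toℕ j))

{-# OPTIONS --safe #-}

-- Think of the rows of a descending plane partition as paths moving one place to
-- the right per unit of time, all starting together at their heads.  Strictness of
-- the columns says that the values at time c + 1 interlace those at time c, and
-- conditions (3) and (4) say that the lengths interlace the heads.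
--
-- Split the matrix row with index h - 1 (for a possible head h) into the row of
-- binomial coefficients, whose l-th entry counts the weakly decreasing sequences of
-- length l starting with h, and the row with entries 1 and -1 in the columns h - 1
-- and h.  By multilinearity the determinant becomes a sum over the sets H of heads.
-- Expand each summand column by column.  Since the rows of binomial coefficients
-- have a leading 1, subtracting consecutive ones turns the expansion into a sum over
-- the interlacing values at the next time, either with no row ending or with the
-- bottom one ending (so no sign-reversing involution on paths is needed).  The rows
-- with entries 1 and -1 contribute precisely the lengths that interlace H.
module Submission where

open import Defs
open import Algebra.Properties.Semiring.Sum using (sum; *-distribˡ-sum; sum-cong-≗)
open import Data.Bool.Base using (Bool; true; false)
open import Data.Empty using (⊥; ⊥-elim)
open import Data.Fin.Base using (Fin; zero; suc; toℕ; punchIn)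
open import Data.Integer.Base using (ℤ; +_; 0ℤ; 1ℤ; -1ℤ; _+_; _*_; _-_; -_; _^_)
import Data.Integer.Properties as ℤ
open import Data.Integer.Tactic.RingSolver using (solve-∀)
open import Data.List.Base using (List; []; _∷_; _++_; map; replicate; length; tabulate; zipWith; reverse; _ʳ++_)
open import Data.List.Membership.Propositional.Properties using (∈-map⁺; ∈-map⁻; ∈-++⁻; ∈-++⁺ˡ; ∈-++⁺ʳ)
open import Data.List.NonEmpty.Base as List⁺ using (List⁺; _∷_; _∷⁺_; toList; head; tail)
open import Data.List.Properties
  using (map-++; map-∘; map-tabulate; tabulate-cong; map-id-local; length-map; length-++;
         ∷-injectiveˡ; ∷-injectiveʳ; reverse-involutive)
open import Data.List.Relation.Binary.Pointwise.Base using (Pointwise; []; _∷_)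
import Data.List.Relation.Binary.Pointwise as Pointwise
open import Data.List.Relation.Binary.Prefix.Heterogeneous using (Prefix; []; _∷_)
open import Data.List.Relation.Unary.All as All using (All; []; _∷_)
import Data.List.Relation.Unary.All.Properties as All
open import Data.List.Relation.Unary.AllPairs using (AllPairs; []; _∷_)
open import Data.List.Relation.Unary.Any using (here; there)
open import Data.List.Relation.Unary.Linked as Linked using (Linked; []; [-]; _∷_)
import Data.List.Relation.Unary.Linked.Properties as Linked
open import Data.List.Relation.Unary.Unique.Propositional using (Unique)
import Data.List.Relation.Unary.Unique.Propositional.Properties as Unique
open import Data.Nat.Base as ℕ
  using (ℕ; zero; suc; _∸_; _≤_; _<_; _≥_; z≤n; s≤s; _≤′_; ≤′-refl; ≤′-step)
open import Data.Nat.Combinatorics using (_C_; nCk+nC[k+1]≡[n+1]C[k+1]; k>n⇒nCk≡0)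
import Data.Nat.Properties as ℕ
open import Data.Product.Base using (∃-syntax; _×_; _,_; proj₁; proj₂)
open import Data.Sum.Base using (_⊎_; inj₁; inj₂; [_,_]′)
open import Data.Unit.Base using (⊤; tt)
open import Function.Base using (_∘_; flip; _on_)
open import Function.Bundles using (_⇔_; mk⇔; module Equivalence)
open import Function.Construct.Composition using (_⇔-∘_)
open import Function.Construct.Symmetry using (⇔-sym)
open import Relation.Binary.PropositionalEquality
open import Relation.Nullary.Decidable.Core using (yes; no)
open import Relation.Nullary.Negation using (¬_)

open Equivalence using (to; from)

private
  variable
    A B : Set
    P Q : A → Set
    y z : ℤ

-- Alternating functions of a list of rows

Row : Set
Row = ℕ → ℤ

infixl 6 _⊕_ _⊖_

_⊕_ _⊖_ : Row → Row → Row
(v ⊕ w) c = v c + w c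
(v ⊖ w) c = v c - w c

shift : Row → Row
shift v = v ∘ suc

infix 4 _≋_

_≋_ : Row → Row → Set
_≋_ = _≗_

≋-refls : ∀ vs → Pointwise _≋_ vs vs
≋-refls vs = Pointwise.refl (λ _ → refl)

map-≋ : ∀ {g : Row → Row} → (∀ {v w} → v ≋ w → g v ≋ g w) →
        ∀ {vs ws} → Pointwise _≋_ vs ws → Pointwise _≋_ (map g vs) (map g ws)
map-≋ g≋ []       = []
map-≋ g≋ (e ∷ es) = g≋ e ∷ map-≋ g≋ es

record Alternating (f : List Row → ℤ) : Set where
  field
    resp-≋   : ∀ {vs ws} → Pointwise _≋_ vs ws → f vs ≡ f ws
    additive : ∀ us v w ws →
               f (us ++ (v ⊕ w) ∷ ws) ≡ f (us ++ v ∷ ws) + f (us ++ w ∷ ws)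
    repeated : ∀ us v ws → f (us ++ v ∷ v ∷ ws) ≡ 0ℤ

  resp-head : ∀ {v w} ws → v ≋ w → f (v ∷ ws) ≡ f (w ∷ ws)
  resp-head ws v≋w = resp-≋ (v≋w ∷ ≋-refls ws)

  zero-row : ∀ {v} ws → v ≋ (λ _ → 0ℤ) → f (v ∷ ws) ≡ 0ℤ
  zero-row {v} ws v≋0 = identity (f (v ∷ ws)) (begin
    f (v ∷ ws)                ≡⟨ resp-head ws (λ c → sym (trans (cong (_+_ (v c)) (v≋0 c)) (ℤ.+-identityʳ (v c)))) ⟩
    f (v ⊕ v ∷ ws)            ≡⟨ additive [] v v ws ⟩
    f (v ∷ ws) + f (v ∷ ws)   ∎)
    where
    open ≡-Reasoning
    double : ∀ x → x ≡ x + x - x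
    double = solve-∀
    identity : ∀ x → x ≡ x + x → x ≡ 0ℤ
    identity x eq = trans (double x) (trans (cong (_- x) (sym eq)) (ℤ.+-inverseʳ x))

  subtractive : ∀ v w ws → f (v ⊖ w ∷ ws) ≡ f (v ∷ ws) - f (w ∷ ws)
  subtractive v w ws = trans (cancel _ _) (cong (_- f (w ∷ ws)) (trans
    (sym (additive [] (v ⊖ w) w ws))
    (resp-head ws (λ c → sym (cancel′ (v c) (w c))))))
    where
    cancel : ∀ x y → x ≡ x + y - y
    cancel = solve-∀
    cancel′ : ∀ x y → x ≡ x - y + y
    cancel′ = solve-∀

  swap : ∀ v w ws → f (v ∷ w ∷ ws) ≡ - f (w ∷ v ∷ ws)
  swap v w ws = solution _ _ _ _ (begin
    0ℤ                                             ≡⟨ repeated [] (v ⊕ w) ws ⟨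
    f (v ⊕ w ∷ v ⊕ w ∷ ws)                         ≡⟨ additive [] v w (v ⊕ w ∷ ws) ⟩
    f (v ∷ v ⊕ w ∷ ws) + f (w ∷ v ⊕ w ∷ ws)        ≡⟨ cong₂ _+_ (additive (v ∷ []) v w ws) (additive (w ∷ []) v w ws) ⟩
    f (v ∷ v ∷ ws) + f (v ∷ w ∷ ws) + (f (w ∷ v ∷ ws) + f (w ∷ w ∷ ws)) ∎)
    (repeated [] v ws) (repeated [] w ws)
    where
    open ≡-Reasoning
    solution : ∀ x p q y → 0ℤ ≡ x + p + (q + y) → x ≡ 0ℤ → y ≡ 0ℤ → p ≡ - q
    solution _ p q _ eq refl refl = begin
      p                            ≡⟨ expand p q ⟩
      (0ℤ + p + (q + 0ℤ)) - q      ≡⟨ cong (_- q) eq ⟨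
      0ℤ - q                       ≡⟨ ℤ.+-identityˡ (- q) ⟩
      - q                          ∎
      where
      expand : ∀ p q → p ≡ (0ℤ + p + (q + 0ℤ)) - q
      expand = solve-∀

open Alternating

prepend : ∀ {f} → Alternating f → ∀ v → Alternating (f ∘ (v ∷_))
prepend alt v = record
  { resp-≋   = λ es → resp-≋ alt ((λ _ → refl) ∷ es)
  ; additive = λ us → additive alt (v ∷ us)
  ; repeated = λ us → repeated alt (v ∷ us)
  }

map-shift : ∀ {f} → Alternating f → Alternating (f ∘ map shift)
map-shift {f} alt = record
  { resp-≋   = λ es → resp-≋ alt (map-≋ (λ e → e ∘ suc) es)
  ; additive = λ us v w ws → trans (cong f (map-++ shift us _)) (trans
      (additive alt (map shift us) (shift v) (shift w) (map shift ws))
      (sym (cong₂ _+_ (cong f (map-++ shift us _)) (cong f (map-++ shift us _)))))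
  ; repeated = λ us v ws → trans (cong f (map-++ shift us _))
      (repeated alt (map shift us) (shift v) (map shift ws))
  }

sum-of-alternating : ∀ {f g} → Alternating f → Alternating g → Alternating (λ vs → f vs + g vs)
sum-of-alternating {f} {g} F G = record
  { resp-≋   = λ es → cong₂ _+_ (resp-≋ F es) (resp-≋ G es)
  ; additive = λ us v w ws → trans (cong₂ _+_ (additive F us v w ws) (additive G us v w ws))
      (medial (f (us ++ v ∷ ws)) _ _ _)
  ; repeated = λ us v ws → cong₂ _+_ (repeated F us v ws) (repeated G us v ws)
  }
  where
  medial : ∀ a b c d → a + b + (c + d) ≡ a + c + (b + d)
  medial = solve-∀

constant-zero : Alternating (λ _ → 0ℤ)
constant-zero = record { resp-≋ = λ _ → refl ; additive = λ _ _ _ _ → refl ; repeated = λ _ _ _ → refl }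

-- Expansion along column 0: the alternating sum, over the rows, of the entry in
-- column 0 times f of the remaining rows with that column removed.
Ω : (List Row → ℤ) → List Row → ℤ
Ω f []       = 0ℤ
Ω f (v ∷ vs) = v 0 * f (map shift vs) - Ω (f ∘ (shift v ∷_)) vs

Ω-cong : ∀ {f g} → (∀ us → f us ≡ g us) → ∀ vs → Ω f vs ≡ Ω g vs
Ω-cong f≡g []       = refl
Ω-cong f≡g (v ∷ vs) =
  cong₂ (λ x y → v 0 * x - y) (f≡g (map shift vs)) (Ω-cong (λ us → f≡g (shift v ∷ us)) vs)

Ω-zero : ∀ {f} → (∀ us → f us ≡ 0ℤ) → ∀ vs → Ω f vs ≡ 0ℤ
Ω-zero f≡0 []       = refl
Ω-zero f≡0 (v ∷ vs) = trans
  (cong₂ (λ x y → v 0 * x - y) (f≡0 (map shift vs)) (Ω-zero (λ us → f≡0 (shift v ∷ us)) vs))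
  (cong (_- 0ℤ) (ℤ.*-zeroʳ (v 0)))

Ω-+ : ∀ f g vs → Ω (λ us → f us + g us) vs ≡ Ω f vs + Ω g vs
Ω-+ f g []       = refl
Ω-+ f g (v ∷ vs) = trans (cong (λ x → v 0 * _ - x) (Ω-+ (f ∘ (shift v ∷_)) (g ∘ (shift v ∷_)) vs))
  (distribute (v 0) (f (map shift vs)) _ _ _)
  where
  distribute : ∀ a x y p q → a * (x + y) - (p + q) ≡ a * x - p + (a * y - q)
  distribute = solve-∀

Ω-* : ∀ c f vs → Ω (λ us → c * f us) vs ≡ c * Ω f vs
Ω-* c f []       = sym (ℤ.*-zeroʳ c)
Ω-* c f (v ∷ vs) = trans (cong (λ x → v 0 * _ - x) (Ω-* c (f ∘ (shift v ∷_)) vs))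
  (distribute (v 0) c _ _)
  where
  distribute : ∀ a c x p → a * (c * x) - c * p ≡ c * (a * x - p)
  distribute = solve-∀

Ω-neg : ∀ f vs → Ω (λ us → - f us) vs ≡ - Ω f vs
Ω-neg f []       = refl
Ω-neg f (v ∷ vs) = trans (cong (λ x → v 0 * _ - x) (Ω-neg (f ∘ (shift v ∷_)) vs))
  (distribute (v 0) _ _)
  where
  distribute : ∀ a x p → a * (- x) - - p ≡ - (a * x - p)
  distribute = solve-∀

Ω-sum : ∀ {n} (g : Fin n → List Row → ℤ) vs →
        Ω (λ us → sum ℤ.+-*-semiring (λ j → g j us)) vs ≡ sum ℤ.+-*-semiring (λ j → Ω (g j) vs)
Ω-sum {zero}  g vs = Ω-zero (λ _ → refl) vs
Ω-sum {suc n} g vs = trans (Ω-+ (g zero) _ vs) (cong (_+_ (Ω (g zero) vs)) (Ω-sum (g ∘ suc) vs))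

Ω-resp-≋ : ∀ {f} → Alternating f → ∀ {vs ws} → Pointwise _≋_ vs ws → Ω f vs ≡ Ω f ws
Ω-resp-≋ alt []       = refl
Ω-resp-≋ {f} alt {v ∷ vs} {w ∷ ws} (e ∷ es) = cong₂ _-_
  (cong₂ _*_ (e 0) (resp-≋ alt (map-≋ (λ e′ → e′ ∘ suc) es)))
  (trans (Ω-resp-≋ (prepend alt (shift v)) es)
         (Ω-cong (λ us → resp-head alt us (e ∘ suc)) ws))

Ω-additive : ∀ {f} → Alternating f → ∀ us v w ws →
             Ω f (us ++ (v ⊕ w) ∷ ws) ≡ Ω f (us ++ v ∷ ws) + Ω f (us ++ w ∷ ws)
Ω-additive {f} alt []       v w ws = trans
  (cong (λ x → (v 0 + w 0) * _ - x)
    (trans (Ω-cong (λ us → additive alt [] (shift v) (shift w) us) ws) (Ω-+ _ _ ws)))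
  (distribute (v 0) (w 0) _ _ _)
  where
  distribute : ∀ a b x p q → (a + b) * x - (p + q) ≡ a * x - p + (b * x - q)
  distribute = solve-∀
Ω-additive {f} alt (u ∷ us) v w ws = trans
  (cong₂ (λ x y → u 0 * x - y) (additive (map-shift alt) us v w ws)
    (Ω-additive (prepend alt (shift u)) us v w ws))
  (distribute (u 0) _ _ _ _)
  where
  distribute : ∀ a x y p q → a * (x + y) - (p + q) ≡ a * x - p + (a * y - q)
  distribute = solve-∀

Ω-repeated : ∀ {f} → Alternating f → ∀ us v ws → Ω f (us ++ v ∷ v ∷ ws) ≡ 0ℤ
Ω-repeated {f} alt []       v ws = trans
  (cong (λ x → v 0 * f (shift v ∷ map shift ws) - (v 0 * f (shift v ∷ map shift ws) - x))
    (Ω-zero (repeated alt [] (shift v)) ws))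
  (cancel (v 0 * f (shift v ∷ map shift ws)))
  where
  cancel : ∀ x → x - (x - 0ℤ) ≡ 0ℤ
  cancel = solve-∀
Ω-repeated {f} alt (u ∷ us) v ws = trans
  (cong₂ (λ x y → u 0 * x - y) (repeated (map-shift alt) us v ws)
    (Ω-repeated (prepend alt (shift u)) us v ws))
  (cong (_- 0ℤ) (ℤ.*-zeroʳ (u 0)))

expansion : ∀ {f} → Alternating f → Alternating (Ω f)
expansion alt = record
  { resp-≋   = Ω-resp-≋ alt
  ; additive = Ω-additive alt
  ; repeated = Ω-repeated alt
  }

-- Entry i of s says whether t + 2 + i is a head, and the arguments of Φ are the rows
-- that have not ended after t steps.  There are as many of them as heads in s in the
-- mode exact, and one fewer in the mode ahead: there the row with the first head in s
-- has already ended, and no other may end before the time reaches that head.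
data Mode : Set where
  exact ahead : Mode

Φ : Mode → List Bool → List Row → ℤ
Φ exact []          []      = 1ℤ
Φ exact []          (_ ∷ _) = 0ℤ
Φ exact (true  ∷ s) vs      = Ω (Φ exact s) vs
Φ exact (false ∷ s) vs      = Φ exact s (map shift vs) + Ω (Φ ahead s) vs
Φ ahead []          vs      = 0ℤ
Φ ahead (true  ∷ s) vs      = Φ exact s (map shift vs)
Φ ahead (false ∷ s) vs      = Φ ahead s (map shift vs)

Φ-alternating : ∀ mode s → Alternating (Φ mode s)
Φ-alternating exact []          = record
  { resp-≋   = λ { [] → refl ; (_ ∷ _) → refl }
  ; additive = λ { [] _ _ _ → refl ; (_ ∷ _) _ _ _ → refl }
  ; repeated = λ { [] _ _ → refl ; (_ ∷ _) _ _ → refl }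
  }
Φ-alternating exact (true  ∷ s) = expansion (Φ-alternating exact s)
Φ-alternating exact (false ∷ s) =
  sum-of-alternating (map-shift (Φ-alternating exact s)) (expansion (Φ-alternating ahead s))
Φ-alternating ahead []          = constant-zero
Φ-alternating ahead (true  ∷ s) = map-shift (Φ-alternating exact s)
Φ-alternating ahead (false ∷ s) = map-shift (Φ-alternating ahead s)

-- With every place taken by a row, Φ is the Laplace expansion along the first column.
detRows : ℕ → List Row → ℤ
detRows n = Φ exact (replicate n true)

-- Laplace expansion along the first row

deleteColumn : ℕ → Row → Row
deleteColumn zero    v c       = v (suc c)
deleteColumn (suc j) v zero    = v zero
deleteColumn (suc j) v (suc c) = deleteColumn j (shift v) c

deleteColumn-punchIn : ∀ {n} (j : Fin (suc n)) k v → deleteColumn (toℕ j) v (toℕ k) ≡ v (toℕ (punchIn j k))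
deleteColumn-punchIn zero    k       v = refl
deleteColumn-punchIn (suc j) zero    v = refl
deleteColumn-punchIn (suc j) (suc k) v = deleteColumn-punchIn j k (shift v)

Ω-deleteColumn : ∀ f j vs → Ω f (map (deleteColumn (suc j)) vs) ≡ Ω (f ∘ map (deleteColumn j)) vs
Ω-deleteColumn f j []       = refl
Ω-deleteColumn f j (v ∷ vs) = cong₂ _-_
  (cong (λ us → v 0 * f us) (trans (sym (map-∘ vs)) (map-∘ vs)))
  (Ω-deleteColumn (f ∘ (deleteColumn j (shift v) ∷_)) j vs)

laplace-first-row : ∀ n v vs → detRows (suc n) (v ∷ vs) ≡
  sum ℤ.+-*-semiring {suc n} (λ j → -1ℤ ^ toℕ j * v (toℕ j) * detRows n (map (deleteColumn (toℕ j)) vs))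
laplace-first-row zero    v vs = trans
  (cong (_-_ (v 0 * detRows 0 (map shift vs))) (Ω-zero (λ _ → refl) vs))
  (cong (_+ 0ℤ) (cong (_* detRows 0 (map shift vs)) (sym (ℤ.*-identityˡ (v 0)))))
laplace-first-row (suc n) v vs = cong₂ _+_
  (cong (_* detRows (suc n) (map shift vs)) (sym (ℤ.*-identityˡ (v 0))))
  (begin
    - Ω (detRows (suc n) ∘ (shift v ∷_)) vs
      ≡⟨ cong -_ (Ω-cong (laplace-first-row n (shift v)) vs) ⟩
    - Ω (λ us → sum ℤ.+-*-semiring {suc n} (term us)) vs
      ≡⟨ cong -_ (Ω-sum (λ j us → term us j) vs) ⟩
    - sum ℤ.+-*-semiring {suc n} (λ j → Ω (λ us → term us j) vs)
      ≡⟨ neg≡-1* _ ⟩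
    -1ℤ * sum ℤ.+-*-semiring {suc n} (λ j → Ω (λ us → term us j) vs)
      ≡⟨ *-distribˡ-sum ℤ.+-*-semiring -1ℤ (λ j → Ω (λ us → term us j) vs) ⟩
    sum ℤ.+-*-semiring {suc n} (λ j → -1ℤ * Ω (λ us → term us j) vs)
      ≡⟨ sum-cong-≗ ℤ.+-*-semiring move ⟩
    sum ℤ.+-*-semiring {suc n} (λ j → -1ℤ ^ suc (toℕ j) * v (suc (toℕ j)) * detRows (suc n) (map (deleteColumn (suc (toℕ j))) vs))
      ∎)
  where
  open ≡-Reasoning
  term : List Row → Fin (suc n) → ℤ
  term us j = -1ℤ ^ toℕ j * v (suc (toℕ j)) * detRows n (map (deleteColumn (toℕ j)) us)
  neg≡-1* : ∀ x → - x ≡ -1ℤ * x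
  neg≡-1* = solve-∀
  assoc : ∀ x y z → -1ℤ * (x * y * z) ≡ -1ℤ * x * y * z
  assoc = solve-∀
  move : ∀ j → -1ℤ * Ω (λ us → term us j) vs ≡
    -1ℤ ^ suc (toℕ j) * v (suc (toℕ j)) * detRows (suc n) (map (deleteColumn (suc (toℕ j))) vs)
  move j = trans
    (cong (-1ℤ *_) (trans
      (Ω-* (-1ℤ ^ toℕ j * v (suc (toℕ j))) (detRows n ∘ map (deleteColumn (toℕ j))) vs)
      (cong (-1ℤ ^ toℕ j * v (suc (toℕ j)) *_) (sym (Ω-deleteColumn (detRows n) (toℕ j) vs)))))
    (assoc (-1ℤ ^ toℕ j) (v (suc (toℕ j))) _)

det≡detRows : ∀ n (A : SquareMatrix n) (rows : Fin n → Row) →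
              (∀ i j → A i j ≡ rows i (toℕ j)) → det A ≡ detRows n (tabulate rows)
det≡detRows zero    A rows eq = refl
det≡detRows (suc n) A rows eq = trans
  (sum-cong-≗ ℤ.+-*-semiring (λ j → cong₂ (λ x y → -1ℤ ^ toℕ j * x * y) (eq zero j) (trans
    (det≡detRows n (minor A j) (deleteColumn (toℕ j) ∘ rows ∘ suc)
      (λ i k → trans (eq (suc i) (punchIn j k)) (sym (deleteColumn-punchIn j k (rows (suc i))))))
    (cong (detRows n) (sym (map-tabulate (rows ∘ suc) (deleteColumn (toℕ j))))))))
  (sym (laplace-first-row n (rows zero) (tabulate (rows ∘ suc))))

-- Separating the rows with entries 1 and -1

basis : ℕ → Row
basis = δ

idle : ℕ → Row
idle k = basis k ⊖ basis (suc k)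

mix : ℕ → List Bool → List Row → List Row
mix k []          vs       = vs
mix k (true  ∷ s) []       = []
mix k (true  ∷ s) (v ∷ vs) = v ∷ mix (suc k) s vs
mix k (false ∷ s) vs       = idle k ∷ mix (suc k) s vs

map-shift-mix : ∀ k s vs → map shift (mix (suc k) s vs) ≡ mix k s (map shift vs)
map-shift-mix k []          vs       = refl
map-shift-mix k (true  ∷ s) []       = refl
map-shift-mix k (true  ∷ s) (v ∷ vs) = cong (shift v ∷_) (map-shift-mix (suc k) s vs)
map-shift-mix k (false ∷ s) vs       = cong (idle k ∷_) (map-shift-mix (suc k) s vs)

mix-zero-row : ∀ {f} → Alternating f → ∀ k s {z} vs → z ≋ (λ _ → 0ℤ) → f (mix k s (z ∷ vs)) ≡ 0ℤ
mix-zero-row alt k []          vs z≋0 = zero-row alt vs z≋0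
mix-zero-row alt k (true  ∷ s) vs z≋0 = zero-row alt (mix (suc k) s vs) z≋0
mix-zero-row alt k (false ∷ s) vs z≋0 = mix-zero-row (prepend alt (idle k)) (suc k) s vs z≋0

-- Expanding removes one of the rows vs of the mix; the rows vs before it each move
-- one place on, x taking the first place, and the sign of the expansion is that of
-- moving them past the idle rows in between.
Ω-mix : ∀ {f} → Alternating f → ∀ k s x vs →
        Ω (f ∘ (x ∷_)) (mix (suc k) s vs) ≡ Ω (λ us → f (mix k s (x ∷ us))) vs
Ω-mix alt k []          x vs       = refl
Ω-mix alt k (true  ∷ s) x []       = refl
Ω-mix {f} alt k (true  ∷ s) x (y ∷ ys) = cong₂ (λ us t → y 0 * f (x ∷ us) - t)
  (map-shift-mix (suc k) s ys) (Ω-mix (prepend alt x) (suc k) s (shift y) ys)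
Ω-mix {f} alt k (false ∷ s) x vs = begin
  0ℤ - Ω (λ us → f (x ∷ idle k ∷ us)) rest
    ≡⟨ ℤ.+-identityˡ _ ⟩
  - Ω (λ us → f (x ∷ idle k ∷ us)) rest
    ≡⟨ cong -_ (Ω-cong (swap alt x (idle k)) rest) ⟩
  - Ω (λ us → - f (idle k ∷ x ∷ us)) rest
    ≡⟨ cong -_ (Ω-neg (λ us → f (idle k ∷ x ∷ us)) rest) ⟩
  - - Ω (λ us → f (idle k ∷ x ∷ us)) rest
    ≡⟨ ℤ.neg-involutive _ ⟩
  Ω (λ us → f (idle k ∷ x ∷ us)) rest
    ≡⟨ Ω-mix (prepend alt (idle k)) (suc k) s x vs ⟩
  Ω (λ us → f (idle k ∷ mix (suc k) s (x ∷ us))) vs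
    ∎
  where
  open ≡-Reasoning
  rest : List Row
  rest = mix (suc (suc k)) s vs

pending : Row
pending = shift (idle 0)

detRows-mix : ∀ s vs → detRows (length s) (mix 0 s vs) ≡ Φ exact s vs
detRows-pending : ∀ s vs → detRows (length s) (mix 0 s (pending ∷ vs)) ≡ - Φ ahead s vs

detRows-mix []          vs       = refl
detRows-mix (true  ∷ s) []       = refl
detRows-mix (true  ∷ s) (v ∷ vs) = cong₂ (λ x y → v 0 * x - y)
  (trans (cong (detRows (length s)) (map-shift-mix 0 s vs)) (detRows-mix s (map shift vs)))
  (trans (Ω-mix (Φ-alternating exact (replicate (length s) true)) 0 s (shift v) vs)
    (Ω-cong (λ us → detRows-mix s (shift v ∷ us)) vs))
detRows-mix (false ∷ s) vs       = trans
  (cong₂ (λ x y → 1ℤ * x - y)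
    (trans (cong (detRows (length s)) (map-shift-mix 0 s vs)) (detRows-mix s (map shift vs)))
    (trans (Ω-mix (Φ-alternating exact (replicate (length s) true)) 0 s pending vs)
      (trans (Ω-cong (detRows-pending s) vs) (Ω-neg (Φ ahead s) vs))))
  (simplify (Φ exact s (map shift vs)) (Ω (Φ ahead s) vs))
  where
  simplify : ∀ x y → 1ℤ * x - - y ≡ x + y
  simplify = solve-∀

detRows-pending []          vs = refl
detRows-pending (true  ∷ s) vs = trans
  (cong₂ (λ x y → -1ℤ * x - y)
    (trans (cong (detRows (length s)) (map-shift-mix 0 s vs)) (detRows-mix s (map shift vs)))
    (Ω-zero (λ us → zero-row (Φ-alternating exact (replicate (length s) true)) us (λ _ → refl)) (mix 1 s vs)))
  (simplify (Φ exact s (map shift vs)))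
  where
  simplify : ∀ x → -1ℤ * x - 0ℤ ≡ - x
  simplify = solve-∀
detRows-pending (false ∷ s) vs = trans
  (cong₂ (λ x y → 1ℤ * x - y)
    (trans (cong (detRows (length s)) (map-shift-mix 0 s (pending ∷ vs)))
      (mix-zero-row alt 0 s (map shift vs) (λ _ → refl)))
    (begin
      Ω (detRows (length s) ∘ (pending ∷_)) (mix 1 s (pending ∷ vs))
        ≡⟨ Ω-mix alt 0 s pending (pending ∷ vs) ⟩
      Ω (λ us → detRows (length s) (mix 0 s (pending ∷ us))) (pending ∷ vs)
        ≡⟨ Ω-cong (detRows-pending s) (pending ∷ vs) ⟩
      Ω (λ us → - Φ ahead s us) (pending ∷ vs)
        ≡⟨ Ω-neg (Φ ahead s) (pending ∷ vs) ⟩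
      - (-1ℤ * Φ ahead s (map shift vs) - Ω (Φ ahead s ∘ (shift pending ∷_)) vs)
        ≡⟨ cong (λ x → - (-1ℤ * Φ ahead s (map shift vs) - x))
             (Ω-zero (λ us → zero-row (Φ-alternating ahead s) us (λ _ → refl)) vs) ⟩
      - (-1ℤ * Φ ahead s (map shift vs) - 0ℤ)
        ∎))
  (simplify (Φ ahead s (map shift vs)))
  where
  open ≡-Reasoning
  alt : Alternating (detRows (length s))
  alt = Φ-alternating exact (replicate (length s) true)
  simplify : ∀ x → 1ℤ * 0ℤ - - (-1ℤ * x - 0ℤ) ≡ - x
  simplify = solve-∀

-- Differences of consecutive rows

diffs : Row → List Row → List Row
diffs w []       = []
diffs w (u ∷ us) = u ⊖ w ∷ diffs u us

f[w∷diffs]≡f[w∷us] : ∀ {f} → Alternating f → ∀ w us → f (w ∷ diffs w us) ≡ f (w ∷ us)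
f[w∷diffs]≡f[w∷us]     alt w []       = refl
f[w∷diffs]≡f[w∷us] {f} alt w (u ∷ us) = begin
  f (w ∷ u ⊖ w ∷ diffs u us)                          ≡⟨ subtractive (prepend alt w) u w (diffs u us) ⟩
  f (w ∷ u ∷ diffs u us) - f (w ∷ w ∷ diffs u us)     ≡⟨ cong₂ _-_ (f[w∷diffs]≡f[w∷us] (prepend alt w) u us) (repeated alt [] w (diffs u us)) ⟩
  f (w ∷ u ∷ us) - 0ℤ                                 ≡⟨ ℤ.+-identityʳ _ ⟩
  f (w ∷ u ∷ us)                                      ∎
  where open ≡-Reasoning

f[diffs]≡f[us] : ∀ {f} → Alternating f → ∀ {z} us → z ≋ (λ _ → 0ℤ) → f (diffs z us) ≡ f us
f[diffs]≡f[us] alt []       z≋0 = refl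
f[diffs]≡f[us] alt (u ∷ us) z≋0 = trans
  (resp-head alt (diffs u us) (λ c → trans (cong (λ x → u c - x) (z≋0 c)) (ℤ.+-identityʳ (u c))))
  (f[w∷diffs]≡f[w∷us] alt u us)

Ω-diffs : ∀ {f} → Alternating f → ∀ v vs → v 0 ≡ 1ℤ → All (λ w → w 0 ≡ 1ℤ) vs →
          Ω f (v ∷ vs) ≡ f (diffs (shift v) (map shift vs))
Ω-diffs {f} alt v []       v₀ []        = trans (cong (λ x → x * f [] - 0ℤ) v₀) (simplify (f []))
  where
  simplify : ∀ x → 1ℤ * x - 0ℤ ≡ x
  simplify = solve-∀
Ω-diffs {f} alt v (w ∷ ws) v₀ (w₀ ∷ e) = begin
  v 0 * f (w′ ∷ map shift ws) - Ω (f ∘ (v′ ∷_)) (w ∷ ws)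
    ≡⟨ cong₂ (λ x y → x * f (w′ ∷ map shift ws) - y) v₀ (Ω-diffs (prepend alt v′) w ws w₀ e) ⟩
  1ℤ * f (w′ ∷ map shift ws) - f (v′ ∷ rest)
    ≡⟨ cong (_- f (v′ ∷ rest)) (trans (ℤ.*-identityˡ _) (sym (f[w∷diffs]≡f[w∷us] alt w′ (map shift ws)))) ⟩
  f (w′ ∷ rest) - f (v′ ∷ rest)
    ≡⟨ subtractive alt w′ v′ rest ⟨
  f (w′ ⊖ v′ ∷ rest)
    ∎
  where
  open ≡-Reasoning
  v′ w′ : Row
  v′ = shift v
  w′ = shift w
  rest : List Row
  rest = diffs w′ (map shift ws)

-- The number of weakly decreasing sequences of c + 1 positive integers starting with a,
-- if a ≥ 1; paths 0 = (1, 0, 0, …) extends the recursion in a.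
paths : ℕ → Row
paths a c = + ((a ℕ.+ c ∸ 1) C c)

shift-paths-suc : ∀ a → shift (paths (suc a)) ≋ shift (paths a) ⊕ paths (suc a)
shift-paths-suc a c rewrite ℕ.+-suc a c = trans
  (cong +_ (trans (sym (nCk+nC[k+1]≡[n+1]C[k+1] (a ℕ.+ c) c)) (ℕ.+-comm ((a ℕ.+ c) C c) _)))
  (ℤ.pos-+ ((a ℕ.+ c) C suc c) ((a ℕ.+ c) C c))

shift-paths-zero : shift (paths 0) ≋ (λ _ → 0ℤ)
shift-paths-zero c = cong +_ (k>n⇒nCk≡0 (ℕ.n<1+n c))

-- Counting with values in ℤ

Card : {A : Set} → (A → Set) → ℤ → Set
Card P z = ∃[ n ] HasCardinality P n × + n ≡ z

Card-⇔ : (∀ x → P x ⇔ Q x) → Card P z → Card Q z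
Card-⇔ P⇔Q (n , (xs , uniq , mem , len) , eq) =
  n , (xs , uniq , (λ x → mk⇔ (to (P⇔Q x) ∘ to (mem x)) (from (mem x) ∘ from (P⇔Q x))) , len) , eq

Card-∅ : (∀ x → ¬ P x) → Card P 0ℤ
Card-∅ ¬P = 0 , ([] , [] , (λ x → mk⇔ (λ ()) (⊥-elim ∘ ¬P x)) , refl) , refl

Card-singleton : ∀ (a : A) → Card (_≡ a) 1ℤ
Card-singleton a = 1 , (a ∷ [] , [] ∷ [] , (λ x → mk⇔ (λ { (here eq) → eq ; (there ()) }) here) , refl) , refl

Card-⊎ : (∀ x → P x → Q x → ⊥) → Card P y → Card Q z → Card (λ x → P x ⊎ Q x) (y + z)
Card-⊎ disjoint (m , (xs , uxs , mxs , lxs) , refl) (n , (ys , uys , mys , lys) , refl) =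
  m ℕ.+ n ,
  (xs ++ ys , Unique.++⁺ uxs uys (λ { {v} (i , j) → disjoint v (to (mxs v) i) (to (mys v) j) }) ,
   (λ x → mk⇔
     (λ i → [ inj₁ ∘ to (mxs x) , inj₂ ∘ to (mys x) ]′ (∈-++⁻ xs i))
     [ ∈-++⁺ˡ ∘ from (mxs x) , ∈-++⁺ʳ xs ∘ from (mys x) ]′) ,
   trans (length-++ xs) (cong₂ ℕ._+_ lxs lys)) ,
  ℤ.pos-+ m n

Card-image : ∀ {P : A → Set} (f : A → B) (g : B → A) → (∀ x → P x → g (f x) ≡ x) →
             Card P z → Card (λ y → ∃[ x ] P x × y ≡ f x) z
Card-image {P = P} f g inverse (n , (xs , uniq , mem , len) , eq) =
  n ,
  (map f xs ,
   Unique.map⁻ {f = g} (subst Unique (sym g∘f) uniq) ,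
   (λ y → mk⇔
     (λ i → let x , x∈xs , y≡fx = ∈-map⁻ f i in x , to (mem x) x∈xs , y≡fx)
     (λ { (x , Px , refl) → ∈-map⁺ f (from (mem x) Px) })) ,
   trans (length-map f xs) len) ,
  eq
  where
  g∘f : map g (map f xs) ≡ xs
  g∘f = trans (sym (map-∘ xs)) (map-id-local (All.tabulate (λ {x} i → inverse x (to (mem x) i))))

Card-interval : ∀ {f} → Alternating f → ∀ ws (P : ℕ → A → Set) →
  (∀ {b c x} → P b x → P c x → b ≡ c) → ∀ {lo a} → lo ≤′ a →
  (∀ b → lo < b → b ≤ a → Card (P b) (f (paths b ∷ ws))) →
  Card (λ x → ∃[ b ] lo < b × b ≤ a × P b x) (f (shift (paths a) ⊖ shift (paths lo) ∷ ws))
Card-interval alt ws P key {lo} ≤′-refl _ = subst (Card _)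
  (sym (zero-row alt ws (λ c → ℤ.+-inverseʳ (shift (paths lo) c))))
  (Card-∅ (λ { x (b , lo<b , b≤lo , _) → ℕ.<-irrefl refl (ℕ.<-≤-trans lo<b b≤lo) }))
Card-interval {f = f} alt ws P key {lo} (≤′-step {a} lo≤a) card = subst (Card _)
  (trans (sym (additive alt [] (shift (paths a) ⊖ shift (paths lo)) (paths (suc a)) ws))
    (resp-head alt ws (λ c → sym (trans (cong (_- shift (paths lo) c) (shift-paths-suc a c))
      (exchange (shift (paths a) c) (paths (suc a) c) (shift (paths lo) c))))))
  (Card-⇔ (λ x → mk⇔
      [ (λ { (b , lo<b , b≤a , Pb) → b , lo<b , ℕ.m≤n⇒m≤1+n b≤a , Pb })
      , (λ Psa → suc a , ℕ.s≤s (ℕ.≤′⇒≤ lo≤a) , ℕ.≤-refl , Psa) ]′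
      λ { (b , lo<b , b≤1+a , Pb) → split lo<b Pb (ℕ.m≤n⇒m<n∨m≡n b≤1+a) })
    (Card-⊎ (λ { x (b , _ , b≤a , Pb) Psa → ℕ.1+n≰n (subst (_≤ a) (key Pb Psa) b≤a) })
      (Card-interval alt ws P key lo≤a (λ b lo<b b≤a → card b lo<b (ℕ.m≤n⇒m≤1+n b≤a)))
      (card (suc a) (ℕ.s≤s (ℕ.≤′⇒≤ lo≤a)) ℕ.≤-refl)))
  where
  exchange : ∀ x p y → x + p - y ≡ x - y + p
  exchange = solve-∀
  split : ∀ {x b} → lo < b → P b x → b < suc a ⊎ b ≡ suc a →
          (∃[ b ] lo < b × b ≤ a × P b x) ⊎ P (suc a) x
  split lo<b Pb (inj₁ (ℕ.s≤s b≤a)) = inj₁ (_ , lo<b , b≤a , Pb)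
  split lo<b Pb (inj₂ refl)        = inj₂ Pb

data Interlaced : ℕ → List ℕ → List ℕ → Set where
  stop : ∀ {lo} → Interlaced lo [] []
  step : ∀ {lo a b as bs} → lo < b → b ≤ a → Interlaced a as bs → Interlaced lo (a ∷ as) (b ∷ bs)

ascending-weaken : ∀ {lo lo′ as} → lo ≤ lo′ → Linked _≤_ (lo′ ∷ as) → Linked _≤_ (lo ∷ as)
ascending-weaken lo≤lo′ [-]          = [-]
ascending-weaken lo≤lo′ (lo′≤a ∷ asc) = ℕ.≤-trans lo≤lo′ lo′≤a ∷ asc

interlaced⇒ascending : ∀ {lo as bs} → Interlaced lo as bs → Linked _≤_ (suc lo ∷ bs)
interlaced⇒ascending stop              = [-]
interlaced⇒ascending (step lo<b b≤a i) =
  lo<b ∷ ascending-weaken (ℕ.m≤n⇒m≤1+n b≤a) (interlaced⇒ascending i)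

Card-interlaced : ∀ {f} → Alternating f → (Q : List ℕ → A → Set) →
  (∀ {bs cs x} → Q bs x → Q cs x → bs ≡ cs) → ∀ {lo as} → Linked _≤_ (lo ∷ as) →
  (∀ bs → Interlaced lo as bs → Card (Q bs) (f (map paths bs))) →
  Card (λ x → ∃[ bs ] Interlaced lo as bs × Q bs x)
       (f (diffs (shift (paths lo)) (map shift (map paths as))))
Card-interlaced alt Q key {as = []} [-] card =
  Card-⇔ (λ x → mk⇔ (λ q → [] , stop , q) (λ { ([] , stop , q) → q })) (card [] stop)
Card-interlaced alt Q key {as = a ∷ as} (lo≤a ∷ asc) card =
  Card-⇔ (λ x → mk⇔
      (λ { (b , lo<b , b≤a , bs , i , q) → b ∷ bs , step lo<b b≤a i , q })
      (λ { (b ∷ bs , step lo<b b≤a i , q) → b , lo<b , b≤a , bs , i , q }))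
    (Card-interval alt (diffs (shift (paths a)) (map shift (map paths as)))
      (λ b x → ∃[ bs ] Interlaced a as bs × Q (b ∷ bs) x)
      (λ { (_ , _ , q) (_ , _ , q′) → ∷-injectiveˡ (key q q′) })
      (ℕ.≤⇒≤′ lo≤a)
      (λ b lo<b b≤a → Card-interlaced (prepend alt (paths b)) (λ bs → Q (b ∷ bs))
        (λ q q′ → ∷-injectiveʳ (key q q′)) asc (λ bs i → card (b ∷ bs) (step lo<b b≤a i))))

-- Following the rows in time

heads : ShiftedArray → List ℕ
heads = map head

-- Rows are listed from the bottom one up, cut off to the entries from a time t on.
-- For a row with head h the index is q = h - t - 2, so that a length below h means at
-- most q entries after the first.  Of the row below, prev lists the entries, and lo
-- is the least number of entries after the first that condition (4) allows.
data Stack : List ℕ → ℕ → List ℕ → ShiftedArray → Set where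
  []    : ∀ {prev lo} → Stack prev lo [] []
  layer : ∀ {prev lo q qs r π} →
          All (0 <_) (toList r) → Linked _≥_ (toList r) → Prefix _<_ prev (tail r) →
          lo ≤ length (tail r) → length (tail r) ≤ q →
          Stack (toList r) (suc q) qs π → Stack prev lo (q ∷ qs) (r ∷ π)

consEach : List ℕ → ShiftedArray → ShiftedArray
consEach = zipWith _∷⁺_

dropHeads : ShiftedArray → ShiftedArray
dropHeads []                  = []
dropHeads ((a ∷ [])     ∷ π) = dropHeads π
dropHeads ((a ∷ b ∷ bs) ∷ π) = (b ∷ bs) ∷ dropHeads π

Grown : ℕ → List ℕ → (ShiftedArray → Set) → ShiftedArray → Set
Grown lo as P ρ = ∃[ π ] (Interlaced lo as (heads π) × P π) × ρ ≡ consEach as π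

Ended : List ℕ → (ShiftedArray → Set) → ShiftedArray → Set
Ended []       P ρ = ⊥
Ended (a ∷ as) P ρ = ∃[ π ] Grown a as P π × ρ ≡ (a ∷ []) ∷ π

heads-consEach : ∀ {lo as} π → Interlaced lo as (heads π) → heads (consEach as π) ≡ as
heads-consEach []      stop         = refl
heads-consEach (r ∷ π) (step _ _ i) = cong (_ ∷_) (heads-consEach π i)

dropHeads-consEach : ∀ {lo as} π → Interlaced lo as (heads π) → dropHeads (consEach as π) ≡ π
dropHeads-consEach []      stop         = refl
dropHeads-consEach (r ∷ π) (step _ _ i) = cong (r ∷_) (dropHeads-consEach π i)

stack-consEach : ∀ {lo as prev l qs π} → Interlaced lo as (heads π) → Stack prev l qs π →
                 Stack (lo ∷ prev) (suc l) (map suc qs) (consEach as π)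
stack-consEach stop []  = []
stack-consEach (step lo<b b≤a i) (layer (0<b ∷ pos) weak col l≤ ≤q st) =
  layer (ℕ.<-≤-trans 0<b b≤a ∷ 0<b ∷ pos) (b≤a ∷ weak) (lo<b ∷ col) (s≤s l≤) (s≤s ≤q) (stack-consEach i st)

stack-dropHeads : ∀ {lo prev l ρ} qs → Stack (lo ∷ prev) (suc l) (map suc qs) ρ →
                  ∃[ π ] (Interlaced lo (heads ρ) (heads π) × Stack prev l qs π) × ρ ≡ consEach (heads ρ) π
stack-dropHeads []       [] = [] , (stop , []) , refl
stack-dropHeads (q ∷ qs) (layer {r = a ∷ b ∷ bs} (_ ∷ pos) (b≤a ∷ weak) (lo<b ∷ col) (s≤s l≤) (s≤s ≤q) st)
  with π , (i , st′) , eq ← stack-dropHeads qs st =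
  (b ∷ bs) ∷ π , (step lo<b b≤a i , layer pos weak col l≤ ≤q st′) , cong (_ ∷_) eq

stack⇔grown : ∀ {lo l as} qs ρ →
  (heads ρ ≡ as × Stack (lo ∷ []) (suc l) (map suc qs) ρ) ⇔ Grown lo as (Stack [] l qs) ρ
stack⇔grown qs ρ = mk⇔ (λ { (refl , st) → stack-dropHeads qs st })
  (λ { (π , (i , st) , refl) → heads-consEach π i , stack-consEach i st })

stack-tails : ∀ {l qs} ρ → Stack [] (suc l) qs ρ ⇔ Stack (0 ∷ []) (suc l) qs ρ
stack-tails ρ = mk⇔
  (λ { [] → [] ; (layer {r = a ∷ b ∷ bs} pos@(_ ∷ 0<b ∷ _) weak _ l≤ ≤q st) → layer pos weak (0<b ∷ []) l≤ ≤q st })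
  (λ { [] → [] ; (layer pos weak _ l≤ ≤q st) → layer pos weak [] l≤ ≤q st })

stack⇔grown₀ : ∀ {l as} qs ρ →
  (heads ρ ≡ as × Stack [] (suc l) (map suc qs) ρ) ⇔ Grown 0 as (Stack [] l qs) ρ
stack⇔grown₀ qs ρ = mk⇔
  (λ { (eq , st) → to (stack⇔grown qs ρ) (eq , to (stack-tails ρ) st) })
  (λ g → let eq , st = from (stack⇔grown qs ρ) g in eq , from (stack-tails ρ) st)

Fits : Mode → List ℕ → ShiftedArray → Set
Fits exact qs       π = Stack [] 0 qs π
Fits ahead []       π = ⊥
Fits ahead (q ∷ qs) π = Stack [] (suc q) qs π

fits-exact-true : ∀ {as} qs ρ → Linked _≤_ (1 ∷ as) →
  (heads ρ ≡ as × Fits exact (0 ∷ map suc qs) ρ) ⇔ Ended as (Fits exact qs) ρ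
fits-exact-true qs ρ asc = mk⇔
  (λ { (refl , layer {r = a ∷ []} _ _ _ _ _ st) → _ , to (stack⇔grown qs _) (refl , st) , refl })
  (go asc)
  where
  go : ∀ {as ρ} → Linked _≤_ (1 ∷ as) → Ended as (Fits exact qs) ρ → heads ρ ≡ as × Fits exact (0 ∷ map suc qs) ρ
  go (0<a ∷ _) (π , g , refl) with eq , st ← from (stack⇔grown qs π) g =
    cong (_ ∷_) eq , layer (0<a ∷ []) [-] [] z≤n z≤n st

fits-exact-false : ∀ {as} qs ρ → Linked _≤_ (1 ∷ as) →
  (heads ρ ≡ as × Fits exact (map suc qs) ρ) ⇔ (Grown 0 as (Fits exact qs) ρ ⊎ Ended as (Fits ahead qs) ρ)
fits-exact-false qs ρ asc = mk⇔ (forth qs) [ back₁ , back₂ qs asc ]′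
  where
  forth : ∀ {as ρ} qs → heads ρ ≡ as × Fits exact (map suc qs) ρ → Grown 0 as (Fits exact qs) ρ ⊎ Ended as (Fits ahead qs) ρ
  forth []       (refl , []) = inj₁ ([] , (stop , []) , refl)
  forth (q ∷ qs) (refl , layer {r = a ∷ []} _ _ _ _ _ st) =
    inj₂ (_ , to (stack⇔grown qs _) (refl , st) , refl)
  forth (q ∷ qs) (refl , layer {r = a ∷ b ∷ bs} pos weak col _ ≤q st) =
    inj₁ (to (stack⇔grown₀ (q ∷ qs) _) (refl , layer pos weak col (s≤s z≤n) ≤q st))
  relax : ∀ {qs ρ} → Stack [] 1 qs ρ → Stack [] 0 qs ρ
  relax []                             = []
  relax (layer pos weak col _ ≤q st) = layer pos weak col z≤n ≤q st
  back₁ : ∀ {as ρ} → Grown 0 as (Fits exact qs) ρ → heads ρ ≡ as × Fits exact (map suc qs) ρ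
  back₁ {ρ = ρ} g with eq , st ← from (stack⇔grown₀ qs ρ) g = eq , relax st
  back₂ : ∀ {as ρ} qs → Linked _≤_ (1 ∷ as) → Ended as (Fits ahead qs) ρ → heads ρ ≡ as × Fits exact (map suc qs) ρ
  back₂ (q ∷ qs) (0<a ∷ _) (π , g , refl) with eq , st ← from (stack⇔grown qs π) g =
    cong (_ ∷_) eq , layer (0<a ∷ []) [-] [] z≤n z≤n st
  back₂ [] (0<a ∷ _) (π , (_ , (_ , ()) , _) , refl)

fits-ahead-false : ∀ {as} qs ρ → (heads ρ ≡ as × Fits ahead (map suc qs) ρ) ⇔ Grown 0 as (Fits ahead qs) ρ
fits-ahead-false []       ρ = mk⇔ (λ ()) (λ { (_ , (_ , ()) , _) })
fits-ahead-false (q ∷ qs) ρ = stack⇔grown₀ qs ρ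

grown-ended-disjoint : ∀ {as P Q} ρ → Grown 0 as P ρ → Ended as Q ρ → ⊥
grown-ended-disjoint {a ∷ as} ρ (r ∷ π , _ , refl) (_ , _ , ())
grown-ended-disjoint {a ∷ as} ρ ([] , (() , _) , _) (_ , _ , _)

module _ {f : List Row → ℤ} (alt : Alternating f) {P : ShiftedArray → Set}
  (card : ∀ {bs} → Linked _≤_ (1 ∷ bs) → Card (λ π → heads π ≡ bs × P π) (f (map paths bs))) where

  Card-grown : ∀ {lo as} → Linked _≤_ (lo ∷ as) →
               Card (Grown lo as P) (f (diffs (shift (paths lo)) (map shift (map paths as))))
  Card-grown asc = Card-image _ dropHeads (λ { π (i , _) → dropHeads-consEach π i })
    (Card-⇔ (λ π → mk⇔ (λ { (_ , i , refl , p) → i , p }) (λ { (i , p) → _ , i , refl , p }))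
      (Card-interlaced alt (λ bs π → heads π ≡ bs × P π) (λ { (refl , _) (refl , _) → refl }) asc
        (λ bs i → card (ascending-weaken (s≤s z≤n) (interlaced⇒ascending i)))))

  Card-grown₀ : ∀ {as} → Linked _≤_ (1 ∷ as) → Card (Grown 0 as P) (f (map shift (map paths as)))
  Card-grown₀ {as} asc = subst (Card _) (f[diffs]≡f[us] alt (map shift (map paths as)) shift-paths-zero)
    (Card-grown (ascending-weaken z≤n asc))

  Card-ended : ∀ {as} → Linked _≤_ (1 ∷ as) → Card (Ended as P) (Ω f (map paths as))
  Card-ended {[]}     _         = Card-∅ (λ _ ())
  Card-ended {a ∷ as} (_ ∷ asc) = subst (Card _)
    (sym (Ω-diffs alt (paths a) (map paths as) refl (units as)))
    (Card-image ((a ∷ []) ∷_) (λ { [] → [] ; (_ ∷ π) → π }) (λ _ _ → refl) (Card-grown asc))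
    where
    units : ∀ bs → All (λ w → w 0 ≡ 1ℤ) (map paths bs)
    units []       = []
    units (b ∷ bs) = refl ∷ units bs

trues : ℕ → List Bool → List ℕ
trues k []          = []
trues k (true  ∷ s) = k ∷ trues (suc k) s
trues k (false ∷ s) = trues (suc k) s

trues-suc : ∀ k s → trues (suc k) s ≡ map suc (trues k s)
trues-suc k []          = refl
trues-suc k (true  ∷ s) = cong (suc k ∷_) (trues-suc (suc k) s)
trues-suc k (false ∷ s) = trues-suc (suc k) s

Card-fits : ∀ mode s {as} → Linked _≤_ (1 ∷ as) →
            Card (λ π → heads π ≡ as × Fits mode (trues 0 s) π) (Φ mode s (map paths as))
Card-fits exact [] {[]}     _ = Card-⇔
  (λ π → mk⇔ (λ { refl → refl , [] }) (λ { (_ , []) → refl })) (Card-singleton [])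
Card-fits exact [] {a ∷ as} _ = Card-∅ (λ { [] (() , _) ; (r ∷ π) (_ , ()) })
Card-fits ahead []          _ = Card-∅ (λ { π (_ , ()) })
Card-fits exact (true  ∷ s) asc rewrite trues-suc 0 s =
  Card-⇔ (λ π → ⇔-sym (fits-exact-true (trues 0 s) π asc))
    (Card-ended (Φ-alternating exact s) (Card-fits exact s) asc)
Card-fits exact (false ∷ s) asc rewrite trues-suc 0 s =
  Card-⇔ (λ π → ⇔-sym (fits-exact-false (trues 0 s) π asc))
    (Card-⊎ grown-ended-disjoint
      (Card-grown₀ (Φ-alternating exact s) (Card-fits exact s) asc)
      (Card-ended (Φ-alternating ahead s) (Card-fits ahead s) asc))
Card-fits ahead (true  ∷ s) asc rewrite trues-suc 0 s =
  Card-⇔ (λ π → ⇔-sym (stack⇔grown₀ (trues 0 s) π))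
    (Card-grown₀ (Φ-alternating exact s) (Card-fits exact s) asc)
Card-fits ahead (false ∷ s) asc rewrite trues-suc 0 s =
  Card-⇔ (λ π → ⇔-sym (fits-ahead-false (trues 0 s) π))
    (Card-grown₀ (Φ-alternating ahead s) (Card-fits ahead s) asc)

-- Summing over the sets of heads

trues-≥ : ∀ k s → All (k ≤_) (trues k s)
trues-≥ k []          = []
trues-≥ k (true  ∷ s) = ℕ.≤-refl ∷ All.map ℕ.<⇒≤ (trues-≥ (suc k) s)
trues-≥ k (false ∷ s) = All.map ℕ.<⇒≤ (trues-≥ (suc k) s)

trues-< : ∀ k s → All (_< k ℕ.+ length s) (trues k s)
trues-< k []          = []
trues-< k (b ∷ s) with trues-< (suc k) s
trues-< k (true  ∷ s) | below rewrite ℕ.+-suc k (length s) = s≤s (ℕ.m≤m+n k (length s)) ∷ below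
trues-< k (false ∷ s) | below rewrite ℕ.+-suc k (length s) = below

trues-ascending : ∀ k s → Linked _≤_ (k ∷ trues k s)
trues-ascending k []          = [-]
trues-ascending k (true  ∷ s) = ℕ.≤-refl ∷ ascending-weaken (ℕ.n≤1+n k) (trues-ascending (suc k) s)
trues-ascending k (false ∷ s) = ascending-weaken (ℕ.n≤1+n k) (trues-ascending (suc k) s)

trues-injective : ∀ k s t → length s ≡ length t → trues k s ≡ trues k t → s ≡ t
trues-injective k []          []          _  _  = refl
trues-injective k (true  ∷ s) (true  ∷ t) ls eq =
  cong (true ∷_) (trues-injective (suc k) s t (ℕ.suc-injective ls) (∷-injectiveʳ eq))
trues-injective k (false ∷ s) (false ∷ t) ls eq =
  cong (false ∷_) (trues-injective (suc k) s t (ℕ.suc-injective ls) eq)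
trues-injective k (true  ∷ s) (false ∷ t) ls eq with k<k ∷ _ ← subst (All (suc k ≤_)) (sym eq) (trues-≥ (suc k) t) =
  ⊥-elim (ℕ.<-irrefl refl k<k)
trues-injective k (false ∷ s) (true  ∷ t) ls eq with k<k ∷ _ ← subst (All (suc k ≤_)) eq (trues-≥ (suc k) s) =
  ⊥-elim (ℕ.<-irrefl refl k<k)

trues-surjective : ∀ k n {hs} → AllPairs _<_ hs → All (k ≤_) hs → All (_< k ℕ.+ n) hs →
                   ∃[ s ] length s ≡ n × trues k s ≡ hs
trues-surjective k zero    {[]}     _ _ _ = [] , refl , refl
trues-surjective k zero    {h ∷ hs} _ (k≤h ∷ _) (h<k ∷ _) =
  ⊥-elim (ℕ.<⇒≱ (subst (h <_) (ℕ.+-identityʳ k) h<k) k≤h)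
trues-surjective k (suc n) {[]}     _ _ _
  with s , len , eq ← trues-surjective (suc k) n [] [] [] = false ∷ s , cong suc len , eq
trues-surjective k (suc n) {h ∷ hs} (h< ∷ asc) (k≤h ∷ _) below rewrite ℕ.+-suc k n with k ℕ.≟ h
... | yes refl with s , len , eq ← trues-surjective (suc k) n asc h< (All.tail below) =
  true ∷ s , cong suc len , cong (k ∷_) eq
... | no k≢h with s , len , eq ← trues-surjective (suc k) n (h< ∷ asc)
      (ℕ.≤∧≢⇒< k≤h k≢h ∷ All.map (ℕ.≤-<-trans k≤h) h<) below =
  false ∷ s , cong suc len , eq

matrixRow : ℕ → Row
matrixRow k = idle k ⊕ paths (2 ℕ.+ k)

matrixRows : ℕ → ℕ → List Row
matrixRows k zero    = []
matrixRows k (suc n) = matrixRow k ∷ matrixRows (suc k) n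

Card-choices : ∀ {f} → Alternating f → ∀ k n (P : List Bool → A → Set) →
  (∀ {s t x} → length s ≡ length t → P s x → P t x → s ≡ t) →
  (∀ s → length s ≡ n → Card (P s) (f (mix k s (map paths (trues (2 ℕ.+ k) s))))) →
  Card (λ x → ∃[ s ] length s ≡ n × P s x) (f (matrixRows k n))
Card-choices alt k zero    P key card = Card-⇔
  (λ x → mk⇔ (λ p → [] , refl , p) (λ { ([] , _ , p) → p })) (card [] refl)
Card-choices alt k (suc n) P key card = subst (Card _)
  (sym (additive alt [] (idle k) (paths (2 ℕ.+ k)) (matrixRows (suc k) n)))
  (Card-⇔ (λ x → mk⇔
      [ (λ { (s , len , p) → false ∷ s , cong suc len , p })
      , (λ { (s , len , p) → true  ∷ s , cong suc len , p }) ]′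
      (λ { (false ∷ s , len , p) → inj₁ (s , ℕ.suc-injective len , p)
         ; (true  ∷ s , len , p) → inj₂ (s , ℕ.suc-injective len , p) }))
    (Card-⊎ disjoint
      (Card-choices (prepend alt (idle k)) (suc k) n (P ∘ (false ∷_))
        (λ len p q → ∷-injectiveʳ (key (cong suc len) p q)) (λ s len → card (false ∷ s) (cong suc len)))
      (Card-choices (prepend alt (paths (2 ℕ.+ k))) (suc k) n (P ∘ (true ∷_))
        (λ len p q → ∷-injectiveʳ (key (cong suc len) p q)) (λ s len → card (true ∷ s) (cong suc len)))))
  where
  disjoint : ∀ x → ∃[ s ] length s ≡ n × P (false ∷ s) x → ∃[ s ] length s ≡ n × P (true ∷ s) x → ⊥
  disjoint x (s , ls , p) (t , lt , q) with () ← key {false ∷ s} {true ∷ t} (cong suc (trans ls (sym lt))) p q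

entry≡matrixRow : ∀ i j → entry (suc i) (suc j) ≡ matrixRow i j
entry≡matrixRow i j rewrite ℕ.+-comm i 1 | ℕ.+-suc i j =
  exchange (+ (suc (i ℕ.+ j) C j)) (δ i j) (δ (suc i) j)
  where
  exchange : ∀ p d e → p + d - e ≡ d - e + p
  exchange = solve-∀

tabulate-matrixRow : ∀ k n → tabulate {n = n} (λ i → matrixRow (k ℕ.+ toℕ i)) ≡ matrixRows k n
tabulate-matrixRow k zero    = refl
tabulate-matrixRow k (suc n) = cong₂ _∷_ (cong matrixRow (ℕ.+-identityʳ k))
  (trans (tabulate-cong (λ i → cong matrixRow (ℕ.+-suc k (toℕ i)))) (tabulate-matrixRow (suc k) n))

det≡detRows-matrixRows : ∀ n → det (dppMatrix n) ≡ detRows n (matrixRows 0 n)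
det≡detRows-matrixRows n = trans
  (det≡detRows n (dppMatrix n) (matrixRow ∘ toℕ) (λ i j → entry≡matrixRow (toℕ i) (toℕ j)))
  (cong (detRows n) (tabulate-matrixRow 0 n))

Encoded : List Bool → ShiftedArray → Set
Encoded s π = heads π ≡ trues 2 s × Stack [] 0 (trues 0 s) π

Card-encoded : ∀ n → Card (λ π → ∃[ s ] length s ≡ n × Encoded s π) (det (dppMatrix n))
Card-encoded n = subst (Card _) (sym (det≡detRows-matrixRows n))
  (Card-choices (Φ-alternating exact (replicate n true)) 0 n Encoded
    (λ { {s} {t} len (eq , _) (eq′ , _) → trues-injective 2 s t len (trans (sym eq) eq′) })
    (λ { s refl → subst (Card (Encoded s)) (sym (detRows-mix s (map paths (trues 2 s))))
      (Card-fits exact s (ascending-weaken (s≤s z≤n) (trues-ascending 2 s))) }))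

-- Comparison with the definition

RowValid : List⁺ ℕ → Set
RowValid r = All (0 <_) (toList r) × Linked _≥_ (toList r) × List⁺.length r < head r

Below : List⁺ ℕ → List⁺ ℕ → Set
Below s r = Prefix _<_ (toList s) (tail r) × head s ≤ List⁺.length r

Above : List ℕ → ℕ → ShiftedArray → Set
Above prev lo []      = ⊤
Above prev lo (r ∷ π) = Prefix _<_ prev (tail r) × lo ≤ length (tail r)

toStack : ∀ {prev lo} qs π → heads π ≡ map suc (map suc qs) → All RowValid π → Linked Below π →
          Above prev lo π → Stack prev lo qs π
toStack []       []      eq   _ _ _ = []
toStack (q ∷ qs) (r ∷ π) eq ((pos , weak , len) ∷ valid) linked (col , lo≤)
  with refl ← ∷-injectiveˡ eq =
  layer pos weak col lo≤ (ℕ.s≤s⁻¹ (ℕ.s≤s⁻¹ len))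
    (toStack qs π (∷-injectiveʳ eq) valid (Linked.tail linked) (next linked))
  where
  next : ∀ {π} → Linked Below (r ∷ π) → Above (toList r) (suc q) π
  next [-]               = tt
  next ((col , le) ∷ _) = col , ℕ.s≤s⁻¹ le

fromStack : ∀ {prev lo} qs π → heads π ≡ map suc (map suc qs) → Stack prev lo qs π →
            All RowValid π × Linked Below π × Above prev lo π
fromStack []       []      eq []  = [] , [] , tt
fromStack (q ∷ qs) (r ∷ π) eq (layer pos weak col lo≤ ≤q st)
  with valid , linked , above ← fromStack qs π (∷-injectiveʳ eq) st =
  (pos , weak , subst (_ <_) (sym (∷-injectiveˡ eq)) (s≤s (s≤s ≤q))) ∷ valid , join π above linked , col , lo≤
  where
  join : ∀ π → Above (toList r) (suc q) π → Linked Below π → Linked Below (r ∷ π)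
  join []      _          _      = [-]
  join (t ∷ _) (col , le) linked = (col , subst (_≤ List⁺.length t) (sym (∷-injectiveˡ eq)) (s≤s le)) ∷ linked

Bounded : ℕ → List⁺ ℕ → Set
Bounded m r = All (_≤ m) (toList r)

bounded⇔head≤ : ∀ {m} r → Linked _≥_ (toList r) → Bounded m r ⇔ (head r ≤ m)
bounded⇔head≤ (a ∷ as) weak = mk⇔ All.head
  (λ a≤m → a≤m ∷ All.tail (Linked.Linked⇒All (λ x≥y y≥z → ℕ.≤-trans y≥z x≥y) a≤m weak))

encoded⇔valid : ∀ n π → (∃[ s ] length s ≡ n × Encoded s π) ⇔
                (All RowValid π × Linked Below π × All (Bounded (suc n)) π)
encoded⇔valid n π = mk⇔ forth back
  where
  heads-suc : ∀ s → trues 2 s ≡ map suc (map suc (trues 0 s))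
  heads-suc s = trans (trues-suc 1 s) (cong (map suc) (trues-suc 0 s))

  forth : ∃[ s ] length s ≡ n × Encoded s π → All RowValid π × Linked Below π × All (Bounded (suc n)) π
  forth (s , refl , eq , st) with valid , linked , _ ← fromStack (trues 0 s) π (trans eq (heads-suc s)) st =
    valid , linked ,
    All.zipWith (λ { {r} ((_ , weak , _) , s≤s h≤) → from (bounded⇔head≤ r weak) h≤ })
      (valid , All.map⁻ (subst (All (_< 2 ℕ.+ length s)) (sym eq) (trues-< 2 s)))

  strict : ∀ {π} → All RowValid π → Linked Below π → Linked (_<_ on head) π
  strict _                       []                 = []
  strict _                       [-]                = [-]
  strict (_ ∷ (v@(_ , _ , len) ∷ vs)) ((_ , le) ∷ linked) = ℕ.≤-<-trans le len ∷ strict (v ∷ vs) linked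

  back : All RowValid π × Linked Below π × All (Bounded (suc n)) π → ∃[ s ] length s ≡ n × Encoded s π
  back (valid , linked , bounded) with trues-surjective 2 n
      (Linked.Linked⇒AllPairs ℕ.<-trans (Linked.map⁺ (strict valid linked)))
      (All.map⁺ (All.map (λ { (_ , _ , len) → ℕ.≤-<-trans (s≤s z≤n) len }) valid))
      (All.map⁺ (All.map (λ { (h≤ ∷ _) → s≤s h≤ }) bounded))
  ... | s , len , eq = s , len , sym eq ,
    toStack (trues 0 s) π (trans (sym eq) (heads-suc s)) valid linked (bottom π)
    where
    bottom : ∀ π → Above [] 0 π
    bottom []      = tt
    bottom (_ ∷ _) = [] , z≤n

All-ʳ++ : ∀ {P : A → Set} {xs ys} → All P xs → All P ys → All P (xs ʳ++ ys)
All-ʳ++ []       qs = qs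
All-ʳ++ (p ∷ ps) qs = All-ʳ++ ps (p ∷ qs)

Linked-ʳ++ : ∀ {R : A → A → Set} {x xs ys} → Linked R (x ∷ xs) → Linked (flip R) (x ∷ ys) →
             Linked (flip R) (xs ʳ++ (x ∷ ys))
Linked-ʳ++ [-]     acc = acc
Linked-ʳ++ (r ∷ l) acc = Linked-ʳ++ l (r ∷ acc)

Linked-reverse : ∀ {R : A → A → Set} {xs} → Linked R xs → Linked (flip R) (reverse xs)
Linked-reverse []        = []
Linked-reverse [-]       = [-]
Linked-reverse l@(_ ∷ _) = Linked-ʳ++ l [-]

valid⇔dpp : ∀ m π → (All RowValid π × Linked Below π × All (Bounded m) π) ⇔
            (IsDescendingPlanePartition (reverse π) × HasDimension m (reverse π))
valid⇔dpp m π = mk⇔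
  (λ (valid , linked , bounded) →
    let valid′  = All-ʳ++ valid []
        linked′ = Linked-reverse linked
    in record
      { positive       = All.map proj₁ valid′
      ; rows-weak      = All.map (proj₁ ∘ proj₂) valid′
      ; columns-strict = Linked.map proj₁ linked′
      ; length<first   = All.map (proj₂ ∘ proj₂) valid′
      ; first≤previous = Linked.map proj₂ linked′
      } , All-ʳ++ bounded [])
  (λ (dpp , bounded) → let open IsDescendingPlanePartition dpp in
    subst (All RowValid) (reverse-involutive π)
      (All-ʳ++ (All.zip (positive , All.zip (rows-weak , length<first))) []) ,
    subst (Linked Below) (reverse-involutive π)
      (Linked-reverse (Linked.zip (columns-strict , first≤previous))) ,
    subst (All (Bounded m)) (reverse-involutive π) (All-ʳ++ bounded []))

corollary7 : (m : ℕ) → 1 ≤ m →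
    ∃[ n ] (HasCardinality (λ π → IsDescendingPlanePartition π × HasDimension m π) n
    × + n ≡ det (dppMatrix (m ∸ 1)))
corollary7 (suc n) _ = Card-⇔
  (λ π → mk⇔
    (λ { (ρ , p , refl) → p })
    (λ p → reverse π , subst IsDPP (sym (reverse-involutive π)) p , sym (reverse-involutive π)))
  (Card-image reverse reverse (λ π _ → reverse-involutive π)
    (Card-⇔ (λ π → valid⇔dpp (suc n) π ⇔-∘ encoded⇔valid n π)
      (Card-encoded n)))
  where
  IsDPP : ShiftedArray → Set
  IsDPP π = IsDescendingPlanePartition π × HasDimension (suc n) π
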